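{- Let $H=\{h_0=0,h_1,\dots,h_{n-1},h_n,\rightarrow\}$ be an Arf numerical semigroup and let $x\in \mathrm{G}(H)$ be a gap of $H$. Assume that $h_i<x<h_{i+1}$ with $0\le i\le n-1$. Then $x\in \mathrm{ArfG}(H)$ if and only if $x\in \mathrm{SG}(H)$, $2x-h_i\in H$ and $2h_{i+1}-x\in H$.
   Context: $\mathbb{N}$ is the set of non-negative integers. A numerical semigroup is a subset $H\subseteq\mathbb{N}$ that contains $0$, is closed under addition, and has finite complement in $\mathbb{N}$. It is Arf if $2a-b\in H$ for all $a,b\in H$ with $a\ge b$ (equivalently $a+b-c\in H$ for all $a\ge b\ge c$ in $H$). The notation $H=\{h_0=0,h_1,\dots,h_n,\rightarrow\}$ means that $h_0<h_1<\dots<h_n$ are the small elements of $H$ listed increasingly, $h_n$ being the conductor of $H$ (the least element such that all integers $\ge h_n$ belong to $H$). $\mathrm{G}(H)=\mathbb{N}\setminus H$ is the set of gaps. For $x,y\in\mathbb{Z}$ write $x\le_H y$ if $y-x\in H$; $\mathrm{PF}(H)$ (pseudo-Frobenius numbers) is the set of maximal elements of $\mathbb{Z}\setminus H$ with respect to $\le_H$, and $\mathrm{SG}(H)=\{x\in \mathrm{PF}(H): 2x\in H\}$ is the set of special gaps. For $H$ Arf, the set of Arf special gaps is $\mathrm{ArfG}(H)=\{x\in \mathrm{SG}(H): H\cup\{x\}\text{ is an Arf numerical semigroup}\}$. -}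

module Defs where

open import Data.Fin as Fin using (Fin; fromℕ)
open import Data.Integer as ℤ using (ℤ; +_)
open import Data.List using (List)
open import Data.List.Membership.Propositional using () renaming (_∈_ to _∈ˡ_)
open import Data.Nat using (ℕ; suc; _+_; _*_; _∸_; _≤_; _<_)
open import Data.Product using (∃; ∃-syntax; _×_)
open import Function.Bundles using (_⇔_)
open import Level using (Level; _⊔_)
open import Relation.Binary.Core using (Rel; _Preserves_⟶_)
open import Relation.Binary.PropositionalEquality using (_≡_)
open import Relation.Unary using (Pred; _∈_; ∁; _∪_; ｛_｝)

private
  variable
    a ℓ ℓ′ : Level
    A : Set a

Finite : Pred A ℓ → Set _
Finite {A = A} P = ∃[ xs ] (∀ (x : A) → x ∈ P ⇔ x ∈ˡ xs)

Maximal : Rel A ℓ → Pred A ℓ′ → Pred A _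
Maximal _≼_ P x = x ∈ P × (∀ y → y ∈ P → x ≼ y → y ≡ x)

G : Pred ℕ ℓ → Pred ℕ ℓ
G H = ∁ H

record IsNumericalSemigroup (H : Pred ℕ ℓ) : Set ℓ where
  field
    0∈H      : 0 ∈ H
    +-closed : ∀ {a b} → a ∈ H → b ∈ H → a + b ∈ H
    cofinite : Finite (G H)

record IsArf (H : Pred ℕ ℓ) : Set ℓ where
  field
    isNumericalSemigroup : IsNumericalSemigroup H
    -- As b ≤ a, the subtraction is never truncated.
    arf : ∀ {a b} → a ∈ H → b ∈ H → b ≤ a → 2 * a ∸ b ∈ H

ContainsFrom : Pred ℕ ℓ → Pred ℕ ℓ
ContainsFrom H c = ∀ m → c ≤ m → m ∈ H

IsConductor : Pred ℕ ℓ → Pred ℕ ℓ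
IsConductor H c = ContainsFrom H c × (∀ d → ContainsFrom H d → c ≤ d)

-- H = {h₀ = 0, h₁, …, hₙ, →}.  The small elements of H are those not exceeding
-- its conductor hₙ.  In particular such a listing makes membership in H
-- decidable, so no separate decidability hypothesis on H is needed.
record IsListing (H : Pred ℕ ℓ) {n : ℕ} (h : Fin (suc n) → ℕ) : Set ℓ where
  field
    h₀≡0       : h Fin.zero ≡ 0
    increasing : h Preserves Fin._<_ ⟶ _<_
    conductor  : IsConductor H (h (fromℕ n))
    small      : ∀ m → (m ∈ H × m ≤ h (fromℕ n)) ⇔ (∃[ j ] h j ≡ m)

-- H viewed as a subset of ℤ.
inℤ : Pred ℕ ℓ → Pred ℤ ℓ
inℤ H z = ∃[ m ] (m ∈ H × z ≡ + m)

_≤[_]_ : ℤ → Pred ℕ ℓ → ℤ → Set ℓ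
x ≤[ H ] y = y ℤ.- x ∈ inℤ H

PF : Pred ℕ ℓ → Pred ℤ ℓ
PF H = Maximal (λ x y → x ≤[ H ] y) (∁ (inℤ H))

SG : Pred ℕ ℓ → Pred ℤ ℓ
SG H x = x ∈ PF H × + 2 ℤ.* x ∈ inℤ H

-- A special gap x is non-negative because 2x ∈ H, so nothing is lost by
-- letting x range over ℕ here.
ArfG : Pred ℕ ℓ → Pred ℕ ℓ
ArfG H x = + x ∈ SG H × IsArf (H ∪ ｛ x ｝)

{-# OPTIONS --safe #-}

-- The Arf condition 2a − b ∈ H implies its three-term form a + b − c ∈ H, by
-- Euclid's algorithm on the differences a − c and b − c.  As H has no element
-- strictly between hᵢ and hᵢ₊₁, the conditions at b = hᵢ and a = hᵢ₊₁ then
-- propagate to 2x − b for every b < x and to 2a − x for every a > x in H.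
module Submission where

open import Defs
open import Data.Fin using (Fin; fromℕ; inject₁) renaming (suc to fsuc; _≤_ to _≤ᶠ_)
import Data.Fin.Properties as Fin
open import Data.Integer using (+_)
import Data.Integer.Properties as ℤ
open import Data.List using (filter)
open import Data.List.Membership.Propositional.Properties using (∈-filter⁺; ∈-filter⁻)
open import Data.Nat using (ℕ; zero; suc; _+_; _*_; _∸_; _<_; _≤_; _≤?_; _≟_; z<s)
open import Data.Nat.Induction using (<-rec)
open import Data.Nat.Properties
open import Data.Nat.Tactic.RingSolver using (solve-∀)
open import Data.Product using (_×_; _,_; proj₁; proj₂)
open import Data.Sum using (_⊎_; inj₁; inj₂; [_,_]′)
open import Function using (_∘_)
open import Function.Bundles using (_⇔_; mk⇔; Equivalence)
open import Relation.Binary.PropositionalEquality using (_≡_; _≢_; refl; sym; trans; cong; subst; module ≡-Reasoning)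
open import Relation.Nullary using (yes; no; contradiction; ¬?)
import Relation.Nullary.Decidable as Dec
open import Relation.Unary using (Pred; Decidable; _∈_; _∪_; ｛_｝)

open Equivalence using (to; from)

m+n≡m⇒n≡0 : ∀ m {n} → m + n ≡ m → n ≡ 0
m+n≡m⇒n≡0 m {n} eq = +-cancelˡ-≡ m n 0 (trans eq (sym (+-identityʳ m)))

2*m∸m≡m : ∀ m → 2 * m ∸ m ≡ m
2*m∸m≡m m = trans (m+n∸m≡n m (m + 0)) (+-identityʳ m)

-- Writing the larger term as `c + d` removes the truncated subtraction: reflecting `c` in `c + d`
-- adds the difference `d` once more.
2*[c+d]∸c≡[c+d]+d : ∀ c d → 2 * (c + d) ∸ c ≡ (c + d) + d
2*[c+d]∸c≡[c+d]+d c d = trans (cong (_∸ c) (regroup c d)) (m+n∸m≡n c ((c + d) + d))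
  where
  regroup : ∀ c d → 2 * (c + d) ≡ c + ((c + d) + d)
  regroup = solve-∀

2*m∸n≡m⇒m≡n : ∀ {m n} → n ≤ m → 2 * m ∸ n ≡ m → m ≡ n
2*m∸n≡m⇒m≡n {m} {n} n≤m eq with k , refl ← m≤n⇒∃[o]m+o≡n n≤m =
  trans (cong (_+_ n) k≡0) (+-identityʳ n)
  where
  k≡0 : k ≡ 0
  k≡0 = m+n≡m⇒n≡0 (n + k) (trans (sym (2*[c+d]∸c≡[c+d]+d n k)) eq)

2*m∸n≡n⇒m≡n : ∀ {m n} → n ≤ m → 2 * m ∸ n ≡ n → m ≡ n
2*m∸n≡n⇒m≡n {m} {n} n≤m eq = *-cancelˡ-≡ m n 2 (begin
  2 * m            ≡⟨ m∸n+n≡m (≤-trans n≤m (m≤m+n m _)) ⟨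
  2 * m ∸ n + n    ≡⟨ cong (_+ n) eq ⟩
  n + n            ≡⟨ cong (_+_ n) (+-identityʳ n) ⟨
  2 * n            ∎)
  where open ≡-Reasoning

module _ {ℓ} {H : Pred ℕ ℓ} where

  module _ (arfH : IsArf H) where
    open IsArf arfH

    arf-double : ∀ {c d} → c ∈ H → c + d ∈ H → (c + d) + d ∈ H
    arf-double {c} {d} c∈H c+d∈H =
      subst H (2*[c+d]∸c≡[c+d]+d c d) (arf c+d∈H c∈H (m≤m+n c d))

    -- For the elements `c + d` and `c + k` over the base `c`, the sum minus `c` is `c + (d + k)`.
    -- The index `s`, the sum of both differences, is the measure on which the induction runs.
    ThreeTerm : ℕ → Set ℓ
    ThreeTerm s = ∀ {c} d k → d + k ≡ s → c ∈ H → c + d ∈ H → c + k ∈ H → c + (d + k) ∈ H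

    three-term-step : ∀ s → (∀ {t} → t < s → ThreeTerm t) → ThreeTerm s
    three-term-step s rec {c} d k refl c∈H c+d∈H c+k∈H =
      [ (λ d≤k → ordered d k d≤k refl c+d∈H c+k∈H)
      , (λ k≤d → subst (λ m → c + m ∈ H) (+-comm k d) (ordered k d k≤d (+-comm k d) c+k∈H c+d∈H))
      ]′ (≤-total d k)
      where
      ordered : ∀ d′ k′ → d′ ≤ k′ → d′ + k′ ≡ s → c + d′ ∈ H → c + k′ ∈ H → c + (d′ + k′) ∈ H
      ordered zero k′ _ _ _ c+k′∈H = c+k′∈H
      ordered d′@(suc _) k′ d′≤k′ eq c+d′∈H c+k′∈H with e , refl ← m≤n⇒∃[o]m+o≡n d′≤k′ =
        -- One step of Euclid: the base moves up to `c + d′`. Over it the differences are `d′`, by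
        -- `arf-double`, and `e`; the target element is unchanged, and the measure drops because
        -- `d′` is positive.
        subst H (+-assoc c d′ (d′ + e))
          (rec (subst (d′ + e <_) eq (m<n+m (d′ + e) z<s)) d′ e refl c+d′∈H
            (arf-double c∈H c+d′∈H)
            (subst H (sym (+-assoc c d′ e)) c+k′∈H))

    three-term : ∀ {c d k} → c ∈ H → c + d ∈ H → c + k ∈ H → c + (d + k) ∈ H
    three-term {c} {d} {k} = <-rec ThreeTerm three-term-step (d + k) d k refl

    -- The identity 2x - b = u + (2x - u) - b exhibits the goal as a three-term expression with base
    -- `b`.
    arf-below : ∀ {x u b} → u ≤ x → b ≤ u → u ∈ H → b ∈ H → 2 * x ∸ u ∈ H → 2 * x ∸ b ∈ H
    arf-below {u = u} {b} u≤x b≤u u∈H b∈H 2x∸u∈H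
      with d , refl ← m≤n⇒∃[o]m+o≡n b≤u
      with e , refl ← m≤n⇒∃[o]m+o≡n u≤x =
      subst H (trans (regroup b d e) (sym double-difference))
        (three-term b∈H u∈H (subst H (trans (2*[c+d]∸c≡[c+d]+d (b + d) e) (regroup′ b d e)) 2x∸u∈H))
      where
      regroup : ∀ b d e → b + (d + (d + e + e)) ≡ (b + (d + e)) + (d + e)
      regroup = solve-∀
      regroup′ : ∀ b d e → b + d + e + e ≡ b + (d + e + e)
      regroup′ = solve-∀
      double-difference : 2 * (b + d + e) ∸ b ≡ (b + (d + e)) + (d + e)
      double-difference =
        trans (cong (λ m → 2 * m ∸ b) (+-assoc b d e)) (2*[c+d]∸c≡[c+d]+d b (d + e))

    -- Since 2a - x = (2v - x) + 2(a - v) and 2v - x is at least `v`, two applications of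
    -- `three-term` with base `v` suffice, each adding a - v.
    arf-above : ∀ {x v a} → x ≤ v → v ≤ a → v ∈ H → a ∈ H → 2 * v ∸ x ∈ H → 2 * a ∸ x ∈ H
    arf-above {x} x≤v v≤a v∈H a∈H 2v∸x∈H
      with e , refl ← m≤n⇒∃[o]m+o≡n x≤v
      with k , refl ← m≤n⇒∃[o]m+o≡n v≤a =
      subst H eq
        (three-term v∈H a∈H
          (three-term v∈H a∈H (subst H (2*[c+d]∸c≡[c+d]+d x e) 2v∸x∈H)))
      where
      regroup : ∀ x e k → x + e + (k + (k + e)) ≡ (x + (e + k)) + (e + k)
      regroup = solve-∀
      eq : x + e + (k + (k + e)) ≡ 2 * (x + e + k) ∸ x
      eq = trans (regroup x e k)
        (trans (sym (2*[c+d]∸c≡[c+d]+d x (e + k))) (cong (λ m → 2 * m ∸ x) (sym (+-assoc x e k))))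

  module _ {n} {h : Fin (suc n) → ℕ} (listing : IsListing H h) where
    open IsListing listing

    listing⇒decidable : Decidable H
    listing⇒decidable m with m ≤? h (fromℕ n)
    ... | yes m≤hₙ = Dec.map′ (proj₁ ∘ from (small m)) (λ m∈H → to (small m) (m∈H , m≤hₙ))
                       (Fin.any? (λ j → h j ≟ m))
    ... | no m≰hₙ = yes (proj₁ conductor m (≰⇒≥ m≰hₙ))

    h∈H : ∀ j → h j ∈ H
    h∈H j = proj₁ (from (small (h j)) (j , refl))

    h-mono-≤ : ∀ {j k} → j ≤ᶠ k → h j ≤ h k
    h-mono-≤ {j} {k} j≤k with j Fin.≟ k
    ... | yes refl = ≤-refl
    ... | no j≢k = <⇒≤ (increasing (Fin.≤∧≢⇒< j≤k j≢k))

    no-element-between : ∀ (i : Fin n) {a} → a ∈ H → a ≤ h (inject₁ i) ⊎ h (fsuc i) ≤ a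
    no-element-between i {a} a∈H with a ≤? h (fromℕ n)
    ... | no a≰hₙ = inj₂ (≤-trans (h-mono-≤ (Fin.≤fromℕ (fsuc i))) (≰⇒≥ a≰hₙ))
    ... | yes a≤hₙ with j , refl ← to (small a) (a∈H , a≤hₙ) with j Fin.≤? inject₁ i
    ...   | yes j≤i = inj₁ (h-mono-≤ j≤i)
    -- After `toℕ-inject₁`, the strict inequality from `inject₁ i` to `j` unfolds to `fsuc i ≤ᶠ j`.
    ...   | no j≰i = inj₂ (h-mono-≤ (subst (_< _) (Fin.toℕ-inject₁ i) (≰⇒> j≰i)))

  -- If `x + a` were a gap, it would lie above `x` in the order of `H`, as the difference is `a`;
  -- maximality then forces `x + a` to equal `x`. Decidability turns this refutation into
  -- membership.
  PF-shift : Decidable H → ∀ {x a} → + x ∈ PF H → a ∈ H → a ≢ 0 → x + a ∈ H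
  PF-shift H? {x} {a} (_ , maximal) a∈H a≢0 with H? (x + a)
  ... | yes x+a∈H = x+a∈H
  ... | no x+a∉H = contradiction (m+n≡m⇒n≡0 x (ℤ.+-injective (maximal (+ (x + a))
          (λ { (_ , m∈H , eq) → x+a∉H (subst H (sym (ℤ.+-injective eq)) m∈H) })
          (a , a∈H , difference)))) a≢0
    where
    difference = trans (ℤ.m-n≡m⊖n (x + a) x)
      (trans (ℤ.⊖-≥ (m≤m+n x a)) (cong +_ (m+n∸m≡n x a)))

  SG-double : ∀ {x} → + x ∈ SG H → x + x ∈ H
  SG-double {x} (_ , _ , m∈H , eq) =
    subst H (trans (sym (ℤ.+-injective (trans (ℤ.pos-* 2 x) eq))) (cong (_+_ x) (+-identityʳ x))) m∈H

  -- The new sums are `x + a` and `x + x`. The first is in `H` by the pseudo-Frobenius property,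
  -- except that `a` equal to 0 gives back `x`; the second is in `H` because the gap is special.
  adjoin-special-gap : Decidable H → IsNumericalSemigroup H →
    ∀ {x} → + x ∈ SG H → IsNumericalSemigroup (H ∪ ｛ x ｝)
  adjoin-special-gap H? semigroup {x} x∈SG = record
    { 0∈H = inj₁ 0∈H
    ; +-closed = closed
    ; cofinite = filter ≢x? gaps , λ m → mk⇔
        (λ m∉ → ∈-filter⁺ ≢x? (to (gaps⇔ m) (m∉ ∘ inj₁)) (m∉ ∘ inj₂))
        (λ m∈ → let m∈gaps , x≢m = ∈-filter⁻ ≢x? {xs = gaps} m∈
                in [ from (gaps⇔ m) m∈gaps , x≢m ]′)
    }
    where
    open IsNumericalSemigroup semigroup
    gaps = proj₁ cofinite
    gaps⇔ = proj₂ cofinite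
    ≢x? = λ m → ¬? (x ≟ m)

    shift : ∀ {a} → a ∈ H → x + a ∈ H ∪ ｛ x ｝
    shift {zero} _ = inj₂ (sym (+-identityʳ x))
    shift {suc _} a∈H = inj₁ (PF-shift H? (proj₁ x∈SG) a∈H λ ())

    closed : ∀ {a b} → a ∈ H ∪ ｛ x ｝ → b ∈ H ∪ ｛ x ｝ → a + b ∈ H ∪ ｛ x ｝
    closed (inj₁ a∈H) (inj₁ b∈H) = inj₁ (+-closed a∈H b∈H)
    closed {a} (inj₁ a∈H) (inj₂ refl) = subst (H ∪ ｛ x ｝) (+-comm x a) (shift a∈H)
    closed (inj₂ refl) (inj₁ b∈H) = shift b∈H
    closed (inj₂ refl) (inj₂ refl) = inj₁ (SG-double x∈SG)

proposition2p4 : ∀ {ℓ} (H : Pred ℕ ℓ) → IsArf H →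
    (n : ℕ) (h : Fin (suc n) → ℕ) → IsListing H h →
    (x : ℕ) → x ∈ G H →
    (i : Fin n) → h (inject₁ i) < x → x < h (fsuc i) →
    (x ∈ ArfG H) ⇔ (+ x ∈ SG H × 2 * x ∸ h (inject₁ i) ∈ H × 2 * h (fsuc i) ∸ x ∈ H)
proposition2p4 H arfH n h listing x x∉H i u<x x<v = mk⇔ necessary sufficient
  where
  u = h (inject₁ i)
  v = h (fsuc i)
  u∈H = h∈H listing (inject₁ i)
  v∈H = h∈H listing (fsuc i)

  drop-x : ∀ {m} → x ≢ m → m ∈ H ∪ ｛ x ｝ → m ∈ H
  drop-x x≢m = [ (λ m∈H → m∈H) , (λ x≡m → contradiction x≡m x≢m) ]′

  necessary : x ∈ ArfG H → + x ∈ SG H × 2 * x ∸ u ∈ H × 2 * v ∸ x ∈ H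
  necessary (x∈SG , arfHx) = x∈SG
    -- The Arf property of the larger set could return `x` itself. But 2x - u = x would give x = u,
    -- and 2v - x = x would give v = x, against the strict inequalities.
    , drop-x (λ eq → <⇒≢ u<x (sym (2*m∸n≡m⇒m≡n (<⇒≤ u<x) (sym eq))))
        (arf (inj₂ refl) (inj₁ u∈H) (<⇒≤ u<x))
    , drop-x (λ eq → <⇒≢ x<v (sym (2*m∸n≡n⇒m≡n (<⇒≤ x<v) (sym eq))))
        (arf (inj₁ v∈H) (inj₂ refl) (<⇒≤ x<v))
    where open IsArf arfHx

  sufficient : + x ∈ SG H × 2 * x ∸ u ∈ H × 2 * v ∸ x ∈ H → x ∈ ArfG H
  sufficient (x∈SG , 2x∸u∈H , 2v∸x∈H) = x∈SG , record
    { isNumericalSemigroup =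
        adjoin-special-gap (listing⇒decidable listing) isNumericalSemigroup x∈SG
    ; arf = arf′
    }
    where
    open IsArf arfH

    arf′ : ∀ {a b} → a ∈ H ∪ ｛ x ｝ → b ∈ H ∪ ｛ x ｝ → b ≤ a → 2 * a ∸ b ∈ H ∪ ｛ x ｝
    arf′ (inj₁ a∈H) (inj₁ b∈H) b≤a = inj₁ (arf a∈H b∈H b≤a)
    arf′ (inj₂ refl) (inj₂ refl) _ = inj₂ (sym (2*m∸m≡m x))
    arf′ (inj₂ refl) (inj₁ b∈H) b≤x with no-element-between listing i b∈H
    ... | inj₁ b≤u = inj₁ (arf-below arfH (<⇒≤ u<x) b≤u u∈H b∈H 2x∸u∈H)
    ... | inj₂ v≤b = contradiction (≤-trans v≤b b≤x) (<⇒≱ x<v)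
    arf′ (inj₁ a∈H) (inj₂ refl) x≤a with no-element-between listing i a∈H
    ... | inj₁ a≤u = contradiction (≤-trans x≤a a≤u) (<⇒≱ u<x)
    ... | inj₂ v≤a = inj₁ (arf-above arfH (<⇒≤ x<v) v≤a v∈H a∈H 2v∸x∈H)
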